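{- Let $\mathcal B=\{0\}\cup\{m\ge 1:\text{ the base-4 expansion of }m\text{ begins with }1\text{ or }2\}$. For every fixed integer $h\ge 3$, there exist constants $c_h,C_h>0$, depending only on $h$, such that for every integer $n\ge 1$, $$c_h n^{h-2}\le R_{\mathcal B,h}(n+1)-R_{\mathcal B,h}(n)\le C_h n^{h-2}.$$ Moreover, $R_{\mathcal B,h}(n+1)-R_{\mathcal B,h}(n)>0$ for every integer $n\ge 0$.
   Context: $\mathbb N=\{0,1,2,\ldots\}$. For $A\subseteq\mathbb N$ and an integer $h\ge 1$, $R_{A,h}(n)=\#\{(a_1,\ldots,a_h)\in A^h: a_1+\cdots+a_h=n\}$ is the number of ordered representations of $n$ as a sum of $h$ elements of $A$. "Begins with" refers to the leading (most significant) digit; equivalently $\mathcal B=\{0\}\cup\bigcup_{j\ge 0}\{4^j,4^j+1,\ldots,3\cdot 4^j-1\}$. -}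

module Defs where

open import Data.Digit using (toNatDigits)
open import Data.Integer as ℤ using (ℤ; +_)
open import Data.List.Base using (List; []; _∷_; [_]; cartesianProductWith; filter; head; length; upTo)
open import Data.Maybe.Base using (just)
import Data.Maybe.Properties as Maybe
open import Data.Nat using (ℕ; zero; suc; _≤_; _≤?_; _≟_)
open import Data.Product using (_×_)
open import Data.Rational as ℚ using (ℚ)
open import Data.Sum using (_⊎_)
open import Data.Vec.Base as Vec using (Vec; sum)
open import Data.Vec.Relation.Unary.All using (All; all?)
open import Level using (Level; 0ℓ)
open import Relation.Binary.PropositionalEquality using (_≡_)
open import Relation.Nullary.Decidable using (_×-dec_; _⊎-dec_)
open import Relation.Unary using (Pred; Decidable)

private
  variable
    a : Level
    X : Set a

tuples : (h : ℕ) → List X → List (Vec X h)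
tuples zero    xs = [ Vec.[] ]
tuples (suc h) xs = cartesianProductWith Vec._∷_ xs (tuples h xs)

IsRepresentation : Pred ℕ a → (h n : ℕ) → Pred (Vec ℕ h) a
IsRepresentation A h n v = All A v × sum v ≡ n

isRepresentation? : {A : Pred ℕ a} → Decidable A → (h n : ℕ) → Decidable (IsRepresentation A h n)
isRepresentation? A? h n v = all? A? v ×-dec (sum v ≟ n)

-- Summands are naturals, so every representation of n has all its entries in
-- {0, …, n}; restricting the search to that range loses nothing, and each
-- tuple is listed exactly once.
R : {A : Pred ℕ a} → Decidable A → (h n : ℕ) → ℕ
R A? h n = length (filter (isRepresentation? A? h n) (tuples h (upTo (suc n))))

-- toNatDigits lists the most significant digit first.
BeginsWith : (d m : ℕ) → Set
BeginsWith d m = head (toNatDigits 4 m) ≡ just d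

beginsWith? : (d : ℕ) → Decidable (BeginsWith d)
beginsWith? d m = Maybe.≡-dec _≟_ (head (toNatDigits 4 m)) (just d)

𝓑 : Pred ℕ 0ℓ
𝓑 m = m ≡ 0 ⊎ (1 ≤ m × (BeginsWith 1 m ⊎ BeginsWith 2 m))

𝓑? : Decidable 𝓑
𝓑? m = (m ≟ 0) ⊎-dec ((1 ≤? m) ×-dec (beginsWith? 1 m ⊎-dec beginsWith? 2 m))

-- The difference is taken in ℤ: truncated subtraction on ℕ would hide a
-- negative value.
ΔR𝓑 : (h n : ℕ) → ℤ
ΔR𝓑 h n = + R 𝓑? h (suc n) ℤ.- + R 𝓑? h n

fromℤ : ℤ → ℚ
fromℤ z = z ℚ./ 1

{-# OPTIONS --safe #-}

-- Let f = Σ_{m ∈ 𝓑} x^m, so that the differences in question are the coefficients of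
-- (1 − x) f^h. Put g = (1 − x) f, e = (1 − x) f², d = (1 − x) f³. Deleting the last base-4
-- digit gives f(x) = (1 + x + x² + x³) f(x⁴) − x³, which turns into recurrences expressing
-- the coefficients of g, e, d at 4m + i through those at m and m − 1. The recurrence for e
-- keeps e ≤ 2, and a recurrence such as d(4m) = d(m) + 3 d(m−1) − 3 e(m−1) then multiplies
-- the size of d by about 4 when passing from m to 4m, so d grows linearly once it is larger
-- than 2; this holds from index 5 on, which leaves finitely many values to compute. For
-- h > 3 one convolves with the indicator of 𝓑, whose counting function is at least n / 3.

module Submission where

open import Defs
open import Data.Bool.Base using (Bool; true; false; _∧_; _∨_)
open import Data.Digit using (toNatDigits)
open import Data.Integer as ℤ using (ℤ; +_; -[1+_]; 0ℤ; 1ℤ; -1ℤ)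
import Data.Integer.Properties as ℤ
open import Data.Integer.Tactic.RingSolver using (solve-∀)
open import Data.List.Base
  using (List; []; _∷_; _++_; applyUpTo; cartesianProductWith; filter; head; length; map; upTo)
open import Data.Maybe.Base using (Maybe; just)
import Data.Maybe.Properties as Maybe
open import Data.Nat as ℕ using (ℕ; zero; suc; _∸_; _^_; z≤n; s≤s; sz<ss)
open import Data.Nat.Divisibility using (n∣m*n)
open import Data.Nat.DivMod using (m/n<m; m*n/n≡m; +-distrib-/-∣ʳ)
open import Data.Nat.Induction using (Acc; acc; <-rec; <-wellFounded-fast)
import Data.Nat.Properties as ℕ
import Data.Nat.Tactic.RingSolver as ℕ-Solver
open import Data.Product using (_×_; _,_; proj₁; proj₂; ∃₂)
open import Data.Rational as ℚ using (ℚ; 0ℚ; _<_; _≤_; _*_)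
import Data.Rational.Properties as ℚ
import Data.Rational.Unnormalised as ℚᵘ
import Data.Rational.Unnormalised.Properties as ℚᵘ
open import Data.Vec.Base as Vec using (Vec; sum)
open import Data.Vec.Relation.Unary.All using (all?)
open import Function.Base using (_∘_)
open import Relation.Binary.PropositionalEquality
  using (_≡_; refl; sym; trans; cong; cong₂; subst; subst₂)
open import Relation.Nullary.Decidable using (Dec; yes; no; does; from-yes; _×-dec_; _→-dec_)
open import Relation.Unary using (Pred; Decidable)

-- Leading digits

-- The auxiliary function local to toNatDigits has no name outside Data.Digit. The body of
-- pushDigits is left to unification: once the arguments of a recursive call have been
-- abstracted to variables, the constraint in pushDigits-solution determines it.
pushDigits : (p : ℕ) {m : ℕ} → Acc ℕ._<_ m → List ℕ → List ℕ
pushDigits-solution : ∀ n → toNatDigits 4 n ≡ toNatDigits 4 n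
pushDigits p a xs = _
pushDigits-solution n with <-wellFounded-fast n
pushDigits-solution zero    | _ = refl
pushDigits-solution (suc p) | acc wf with does (0 ℕ.<? suc p ℕ./ 4)
... | false = refl
... | true with suc p ℕ./ 4 | wf (m/n<m (suc p) 4 sz<ss) | suc p ℕ.% 4 ∷ []
...   | _ | a | xs = trans {j = pushDigits p a xs} refl refl

-- Digits are pushed on the left and the leading one comes last, so the accumulator, the outer
-- argument `p` and the choice of accessibility proof cannot affect the head.
head-pushDigits : ∀ p q {n} (a b : Acc ℕ._<_ n) xs ys →
                  head (pushDigits p a xs) ≡ head (pushDigits q b ys)
head-pushDigits p q {zero}  _        _        xs ys = refl
head-pushDigits p q {suc n} (acc wf) (acc wg) xs ys with does (0 ℕ.<? suc n ℕ./ 4)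
... | false = refl
... | true  = head-pushDigits p q (wf (m/n<m (suc n) 4 sz<ss)) (wg _)
                (suc n ℕ.% 4 ∷ xs) (suc n ℕ.% 4 ∷ ys)

head-pushDigits-/ : ∀ n m (a : Acc ℕ._<_ (suc n)) xs → suc n ℕ./ 4 ≡ suc m →
                    head (pushDigits n a xs) ≡ head (toNatDigits 4 (suc m))
head-pushDigits-/ n m (acc wf) xs eq
  -- Abstracting the Boolean together with its value at `suc m` excludes the branch in which the
  -- recursion stops.
  with does (0 ℕ.<? suc n ℕ./ 4) | cong (λ q → does (0 ℕ.<? q)) eq
... | true | refl = go eq (wf (m/n<m (suc n) 4 sz<ss)) (suc n ℕ.% 4 ∷ xs)
  where
  go : ∀ {q} → q ≡ suc m → (a : Acc ℕ._<_ q) → ∀ xs →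
       head (pushDigits n a xs) ≡ head (toNatDigits 4 (suc m))
  go refl a xs = head-pushDigits n m a (<-wellFounded-fast (suc m)) xs []

head-toNatDigits : ∀ n m → suc n ℕ./ 4 ≡ suc m →
                   head (toNatDigits 4 (suc n)) ≡ head (toNatDigits 4 (suc m))
head-toNatDigits n m = head-pushDigits-/ n m (<-wellFounded-fast (suc n)) []

-- The indicator of `𝓑` and its base-4 recurrence

fromBool : Bool → ℕ
fromBool true  = 1
fromBool false = 0

β : ℕ → ℕ
β m = fromBool (does (𝓑? m))

β-suc : ∀ n m → suc n ℕ./ 4 ≡ suc m → β (suc n) ≡ β (suc m)
β-suc n m eq = cong leads (head-toNatDigits n m eq)
  where
  leads : Maybe ℕ → ℕ
  leads x = fromBool (does (Maybe.≡-dec ℕ._≟_ x (just 1)) ∨ does (Maybe.≡-dec ℕ._≟_ x (just 2)))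

i+m*4/4 : ∀ i m → i ℕ./ 4 ≡ 0 → (i ℕ.+ m ℕ.* 4) ℕ./ 4 ≡ m
i+m*4/4 i m eq = trans (+-distrib-/-∣ʳ i (n∣m*n m)) (cong₂ ℕ._+_ eq (m*n/n≡m m 4))

b : ℕ → ℤ
b m = + β m

-- The power series 1 and x.
unit : ℕ → ℤ
unit zero    = 1ℤ
unit (suc _) = 0ℤ

X : ℕ → ℤ
X zero    = 0ℤ
X (suc n) = unit n

-- Coefficients of `f(x) = (1 + x + x² + x³) f(x⁴) - x³`. For `m > 0` the last digit does not affect
-- the leading one; for `m = 0` the numbers 0, 1, 2 lie in `𝓑` and 3 does not, whence the correction
-- `unit m` in `b-3`.
b-0 : ∀ m → b (m ℕ.* 4) ≡ b m
b-0 zero    = refl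
b-0 (suc m) = cong +_ (β-suc (3 ℕ.+ m ℕ.* 4) m (i+m*4/4 0 (suc m) refl))

b-1 : ∀ m → b (1 ℕ.+ m ℕ.* 4) ≡ b m
b-1 zero    = refl
b-1 (suc m) = cong +_ (β-suc (4 ℕ.+ m ℕ.* 4) m (i+m*4/4 1 (suc m) refl))

b-2 : ∀ m → b (2 ℕ.+ m ℕ.* 4) ≡ b m
b-2 zero    = refl
b-2 (suc m) = cong +_ (β-suc (5 ℕ.+ m ℕ.* 4) m (i+m*4/4 2 (suc m) refl))

b-3 : ∀ m → b (3 ℕ.+ m ℕ.* 4) ≡ b m ℤ.+ -1ℤ ℤ.* unit m
b-3 zero    = refl
b-3 (suc m) = trans (cong +_ (β-suc (6 ℕ.+ m ℕ.* 4) m (i+m*4/4 3 (suc m) refl)))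
                    (sym (ℤ.+-identityʳ (b (suc m))))

-- The Cauchy product. The recursion shifts `a` and keeps `u` fixed, so inductions only have to vary
-- `a`.
conv : (a u : ℕ → ℤ) → ℕ → ℤ
conv a u zero    = a 0 ℤ.* u 0
conv a u (suc n) = a 0 ℤ.* u (suc n) ℤ.+ conv (a ∘ suc) u n

-- Multiplication by `1 - x`.
δ : (ℕ → ℤ) → ℕ → ℤ
δ u zero    = u 0
δ u (suc n) = u (suc n) ℤ.- u n

g e d : ℕ → ℤ
g = δ b
e = conv b g
d = conv b e

-- The range ends at `24 = 6 * 4` because from there on the recurrences for `d` refer back only to
-- indices at least 5, where the stronger bound holds. That bound fails at 4, since `d 4 = 2`; the
-- weaker one serves below 5.
d-small : ∀ {N} → N ℕ.< 24 → (+ suc N ℤ.≤ + 15 ℤ.* d N) × (5 ℕ.≤ N → + N ℤ.+ + 31 ℤ.≤ + 15 ℤ.* d N)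
d-small = from-yes (ℕ.allUpTo? (λ N → (+ suc N ℤ.≤? + 15 ℤ.* d N)
                                 ×-dec ((5 ℕ.≤? N) →-dec (+ N ℤ.+ + 31 ℤ.≤? + 15 ℤ.* d N))) 24)

-- Convolutions

conv-congˡ : ∀ {a a′ : ℕ → ℤ} u → (∀ m → a m ≡ a′ m) → ∀ n → conv a u n ≡ conv a′ u n
conv-congˡ u a≗a′ zero    = cong (ℤ._* u 0) (a≗a′ 0)
conv-congˡ u a≗a′ (suc n) =
  cong₂ ℤ._+_ (cong (ℤ._* u (suc n)) (a≗a′ 0)) (conv-congˡ u (a≗a′ ∘ suc) n)

conv-congʳ : ∀ a {u u′ : ℕ → ℤ} n → (∀ m → m ℕ.≤ n → u m ≡ u′ m) → conv a u n ≡ conv a u′ n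
conv-congʳ a zero    u≗u′ = cong (a 0 ℤ.*_) (u≗u′ 0 z≤n)
conv-congʳ a (suc n) u≗u′ =
  cong₂ ℤ._+_ (cong (a 0 ℤ.*_) (u≗u′ (suc n) ℕ.≤-refl))
              (conv-congʳ (a ∘ suc) n (λ m m≤n → u≗u′ m (ℕ.m≤n⇒m≤1+n m≤n)))

-- Linearity in the single shape `p + c * q`; the recurrences carry explicit coefficients such as
-- `1ℤ` and `-1ℤ` in order to match it.
conv-+*ˡ : ∀ (a a′ u : ℕ → ℤ) c n →
           conv (λ m → a m ℤ.+ c ℤ.* a′ m) u n ≡ conv a u n ℤ.+ c ℤ.* conv a′ u n
conv-+*ˡ a a′ u c zero    = rearrange (a 0) (a′ 0) (u 0) c
  where
  rearrange : ∀ x y z c → (x ℤ.+ c ℤ.* y) ℤ.* z ≡ x ℤ.* z ℤ.+ c ℤ.* (y ℤ.* z)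
  rearrange = solve-∀
conv-+*ˡ a a′ u c (suc n) =
  trans (cong (λ z → (a 0 ℤ.+ c ℤ.* a′ 0) ℤ.* u (suc n) ℤ.+ z) (conv-+*ˡ (a ∘ suc) (a′ ∘ suc) u c n))
        (rearrange (a 0) (a′ 0) (u (suc n)) c (conv (a ∘ suc) u n) (conv (a′ ∘ suc) u n))
  where
  rearrange : ∀ x y z c p q → (x ℤ.+ c ℤ.* y) ℤ.* z ℤ.+ (p ℤ.+ c ℤ.* q)
                            ≡ (x ℤ.* z ℤ.+ p) ℤ.+ c ℤ.* (y ℤ.* z ℤ.+ q)
  rearrange = solve-∀

conv-+*ʳ : ∀ (a u v : ℕ → ℤ) c n →
           conv a (λ m → u m ℤ.+ c ℤ.* v m) n ≡ conv a u n ℤ.+ c ℤ.* conv a v n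
conv-+*ʳ a u v c zero    = rearrange (a 0) (u 0) (v 0) c
  where
  rearrange : ∀ x y z c → x ℤ.* (y ℤ.+ c ℤ.* z) ≡ x ℤ.* y ℤ.+ c ℤ.* (x ℤ.* z)
  rearrange = solve-∀
conv-+*ʳ a u v c (suc n) =
  trans (cong (λ z → a 0 ℤ.* (u (suc n) ℤ.+ c ℤ.* v (suc n)) ℤ.+ z) (conv-+*ʳ (a ∘ suc) u v c n))
        (rearrange (a 0) (u (suc n)) (v (suc n)) c (conv (a ∘ suc) u n) (conv (a ∘ suc) v n))
  where
  rearrange : ∀ x y z c p q → x ℤ.* (y ℤ.+ c ℤ.* z) ℤ.+ (p ℤ.+ c ℤ.* q)
                            ≡ (x ℤ.* y ℤ.+ p) ℤ.+ c ℤ.* (x ℤ.* z ℤ.+ q)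
  rearrange = solve-∀

conv-zeroˡ : ∀ u n → conv (λ _ → 0ℤ) u n ≡ 0ℤ
conv-zeroˡ u zero    = refl
conv-zeroˡ u (suc n) = trans (ℤ.+-identityˡ _) (conv-zeroˡ u n)

conv-unitˡ : ∀ u n → conv unit u n ≡ u n
conv-unitˡ u zero    = ℤ.*-identityˡ (u 0)
conv-unitˡ u (suc n) =
  trans (cong₂ ℤ._+_ (ℤ.*-identityˡ (u (suc n))) (conv-zeroˡ u n)) (ℤ.+-identityʳ (u (suc n)))

conv-unitʳ : ∀ a n → conv a unit n ≡ a n
conv-unitʳ a zero    = ℤ.*-identityʳ (a 0)
conv-unitʳ a (suc n) =
  trans (cong₂ ℤ._+_ (ℤ.*-zeroʳ (a 0)) (conv-unitʳ (a ∘ suc) n)) (ℤ.+-identityˡ (a (suc n)))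

conv-X : ∀ a n → conv a X (suc n) ≡ a n
conv-X a zero    =
  trans (cong₂ ℤ._+_ (ℤ.*-identityʳ (a 0)) (ℤ.*-zeroʳ (a 1))) (ℤ.+-identityʳ (a 0))
conv-X a (suc n) =
  trans (cong₂ ℤ._+_ (ℤ.*-zeroʳ (a 0)) (conv-X (a ∘ suc) n)) (ℤ.+-identityˡ (a (suc n)))

δ-conv : ∀ a u n → δ (conv a u) n ≡ conv a (δ u) n
δ-conv a u zero          = refl
δ-conv a u (suc zero)    = rearrange (a 0) (u 1) (u 0) (a 1 ℤ.* u 0)
  where
  rearrange : ∀ x y z w → x ℤ.* y ℤ.+ w ℤ.- x ℤ.* z ≡ x ℤ.* (y ℤ.- z) ℤ.+ w
  rearrange = solve-∀
δ-conv a u (suc (suc n)) =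
  trans (rearrange (a 0) (u (2 ℕ.+ n)) (u (suc n)) (conv (a ∘ suc) u (suc n)) (conv (a ∘ suc) u n))
        (cong (λ z → a 0 ℤ.* (u (2 ℕ.+ n) ℤ.- u (suc n)) ℤ.+ z) (δ-conv (a ∘ suc) u (suc n)))
  where
  rearrange : ∀ x y z p q → x ℤ.* y ℤ.+ p ℤ.- (x ℤ.* z ℤ.+ q) ≡ x ℤ.* (y ℤ.- z) ℤ.+ (p ℤ.- q)
  rearrange = solve-∀

-- Sections of a convolution modulo 4

sect : ℕ → (ℕ → ℤ) → ℕ → ℤ
sect i a m = a (i ℕ.+ m ℕ.* 4)

regroup : ∀ p q r s t w x y →
          p ℤ.+ (q ℤ.+ (r ℤ.+ (s ℤ.+ (t ℤ.+ w ℤ.+ x ℤ.+ y)))) ≡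
          (p ℤ.+ t) ℤ.+ (q ℤ.+ w) ℤ.+ (r ℤ.+ x) ℤ.+ (s ℤ.+ y)
regroup = solve-∀

-- Residues `i` and `j` contribute to residue `i + j` modulo 4, and a carry lowers the quotient from
-- `suc m` to `m`. The induction peels four coefficients off `a`, one per residue, and continues
-- with the shift `a₄`.
conv-sect₀ : ∀ a u m → sect 0 (conv a u) (suc m) ≡
  conv (sect 0 a) (sect 0 u) (suc m) ℤ.+ conv (sect 1 a) (sect 3 u) m
  ℤ.+ conv (sect 2 a) (sect 2 u) m ℤ.+ conv (sect 3 a) (sect 1 u) m
conv-sect₀ a u zero    =
  rearrange (a 0 ℤ.* u 4) (a 1 ℤ.* u 3) (a 2 ℤ.* u 2) (a 3 ℤ.* u 1)
            (a 4 ℤ.* u 0)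
  where
  rearrange : ∀ p q r s t →
              p ℤ.+ (q ℤ.+ (r ℤ.+ (s ℤ.+ t))) ≡
              (p ℤ.+ t) ℤ.+ q ℤ.+ r ℤ.+ s
  rearrange = solve-∀
conv-sect₀ a u (suc m) =
  trans (cong (λ z → a 0 ℤ.* u (8 ℕ.+ m ℕ.* 4) ℤ.+ (a 1 ℤ.* u (7 ℕ.+ m ℕ.* 4)
                 ℤ.+ (a 2 ℤ.* u (6 ℕ.+ m ℕ.* 4) ℤ.+ (a 3 ℤ.* u (5 ℕ.+ m ℕ.* 4) ℤ.+ z))))
              (conv-sect₀ a₄ u m))
        (regroup (a 0 ℤ.* u (8 ℕ.+ m ℕ.* 4)) (a 1 ℤ.* u (7 ℕ.+ m ℕ.* 4))
                 (a 2 ℤ.* u (6 ℕ.+ m ℕ.* 4)) (a 3 ℤ.* u (5 ℕ.+ m ℕ.* 4))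
                 (conv (sect 0 a₄) (sect 0 u) (suc m)) (conv (sect 1 a₄) (sect 3 u) m)
                 (conv (sect 2 a₄) (sect 2 u) m) (conv (sect 3 a₄) (sect 1 u) m))
  where
  a₄ : ℕ → ℤ
  a₄ i = a (4 ℕ.+ i)

conv-sect₁ : ∀ a u m → sect 1 (conv a u) (suc m) ≡
  conv (sect 0 a) (sect 1 u) (suc m) ℤ.+ conv (sect 1 a) (sect 0 u) (suc m)
  ℤ.+ conv (sect 2 a) (sect 3 u) m ℤ.+ conv (sect 3 a) (sect 2 u) m
conv-sect₁ a u zero    =
  rearrange (a 0 ℤ.* u 5) (a 1 ℤ.* u 4) (a 2 ℤ.* u 3) (a 3 ℤ.* u 2)
            (a 4 ℤ.* u 1) (a 5 ℤ.* u 0)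
  where
  rearrange : ∀ p q r s t w →
              p ℤ.+ (q ℤ.+ (r ℤ.+ (s ℤ.+ (t ℤ.+ w)))) ≡
              (p ℤ.+ t) ℤ.+ (q ℤ.+ w) ℤ.+ r ℤ.+ s
  rearrange = solve-∀
conv-sect₁ a u (suc m) =
  trans (cong (λ z → a 0 ℤ.* u (9 ℕ.+ m ℕ.* 4) ℤ.+ (a 1 ℤ.* u (8 ℕ.+ m ℕ.* 4)
                 ℤ.+ (a 2 ℤ.* u (7 ℕ.+ m ℕ.* 4) ℤ.+ (a 3 ℤ.* u (6 ℕ.+ m ℕ.* 4) ℤ.+ z))))
              (conv-sect₁ a₄ u m))
        (regroup (a 0 ℤ.* u (9 ℕ.+ m ℕ.* 4)) (a 1 ℤ.* u (8 ℕ.+ m ℕ.* 4))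
                 (a 2 ℤ.* u (7 ℕ.+ m ℕ.* 4)) (a 3 ℤ.* u (6 ℕ.+ m ℕ.* 4))
                 (conv (sect 0 a₄) (sect 1 u) (suc m)) (conv (sect 1 a₄) (sect 0 u) (suc m))
                 (conv (sect 2 a₄) (sect 3 u) m) (conv (sect 3 a₄) (sect 2 u) m))
  where
  a₄ : ℕ → ℤ
  a₄ i = a (4 ℕ.+ i)

conv-sect₂ : ∀ a u m → sect 2 (conv a u) (suc m) ≡
  conv (sect 0 a) (sect 2 u) (suc m) ℤ.+ conv (sect 1 a) (sect 1 u) (suc m)
  ℤ.+ conv (sect 2 a) (sect 0 u) (suc m) ℤ.+ conv (sect 3 a) (sect 3 u) m
conv-sect₂ a u zero    =
  rearrange (a 0 ℤ.* u 6) (a 1 ℤ.* u 5) (a 2 ℤ.* u 4) (a 3 ℤ.* u 3)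
            (a 4 ℤ.* u 2) (a 5 ℤ.* u 1) (a 6 ℤ.* u 0)
  where
  rearrange : ∀ p q r s t w x →
              p ℤ.+ (q ℤ.+ (r ℤ.+ (s ℤ.+ (t ℤ.+ (w ℤ.+ x))))) ≡
              (p ℤ.+ t) ℤ.+ (q ℤ.+ w) ℤ.+ (r ℤ.+ x) ℤ.+ s
  rearrange = solve-∀
conv-sect₂ a u (suc m) =
  trans (cong (λ z → a 0 ℤ.* u (10 ℕ.+ m ℕ.* 4) ℤ.+ (a 1 ℤ.* u (9 ℕ.+ m ℕ.* 4)
                 ℤ.+ (a 2 ℤ.* u (8 ℕ.+ m ℕ.* 4) ℤ.+ (a 3 ℤ.* u (7 ℕ.+ m ℕ.* 4) ℤ.+ z))))
              (conv-sect₂ a₄ u m))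
        (regroup (a 0 ℤ.* u (10 ℕ.+ m ℕ.* 4)) (a 1 ℤ.* u (9 ℕ.+ m ℕ.* 4))
                 (a 2 ℤ.* u (8 ℕ.+ m ℕ.* 4)) (a 3 ℤ.* u (7 ℕ.+ m ℕ.* 4))
                 (conv (sect 0 a₄) (sect 2 u) (suc m)) (conv (sect 1 a₄) (sect 1 u) (suc m))
                 (conv (sect 2 a₄) (sect 0 u) (suc m)) (conv (sect 3 a₄) (sect 3 u) m))
  where
  a₄ : ℕ → ℤ
  a₄ i = a (4 ℕ.+ i)

conv-sect₃ : ∀ a u m → sect 3 (conv a u) (suc m) ≡
  conv (sect 0 a) (sect 3 u) (suc m) ℤ.+ conv (sect 1 a) (sect 2 u) (suc m)
  ℤ.+ conv (sect 2 a) (sect 1 u) (suc m) ℤ.+ conv (sect 3 a) (sect 0 u) (suc m)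
conv-sect₃ a u zero    =
  rearrange (a 0 ℤ.* u 7) (a 1 ℤ.* u 6) (a 2 ℤ.* u 5) (a 3 ℤ.* u 4)
            (a 4 ℤ.* u 3) (a 5 ℤ.* u 2) (a 6 ℤ.* u 1) (a 7 ℤ.* u 0)
  where
  rearrange : ∀ p q r s t w x y →
              p ℤ.+ (q ℤ.+ (r ℤ.+ (s ℤ.+ (t ℤ.+ (w ℤ.+ (x ℤ.+ y)))))) ≡
              (p ℤ.+ t) ℤ.+ (q ℤ.+ w) ℤ.+ (r ℤ.+ x) ℤ.+ (s ℤ.+ y)
  rearrange = solve-∀
conv-sect₃ a u (suc m) =
  trans (cong (λ z → a 0 ℤ.* u (11 ℕ.+ m ℕ.* 4) ℤ.+ (a 1 ℤ.* u (10 ℕ.+ m ℕ.* 4)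
                 ℤ.+ (a 2 ℤ.* u (9 ℕ.+ m ℕ.* 4) ℤ.+ (a 3 ℤ.* u (8 ℕ.+ m ℕ.* 4) ℤ.+ z))))
              (conv-sect₃ a₄ u m))
        (regroup (a 0 ℤ.* u (11 ℕ.+ m ℕ.* 4)) (a 1 ℤ.* u (10 ℕ.+ m ℕ.* 4))
                 (a 2 ℤ.* u (9 ℕ.+ m ℕ.* 4)) (a 3 ℤ.* u (8 ℕ.+ m ℕ.* 4))
                 (conv (sect 0 a₄) (sect 3 u) (suc m)) (conv (sect 1 a₄) (sect 2 u) (suc m))
                 (conv (sect 2 a₄) (sect 1 u) (suc m)) (conv (sect 3 a₄) (sect 0 u) (suc m)))
  where
  a₄ : ℕ → ℤ
  a₄ i = a (4 ℕ.+ i)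

-- Recurrences modulo 4

data Mod4 : ℕ → Set where
  rem₀ : ∀ m → Mod4 (m ℕ.* 4)
  rem₁ : ∀ m → Mod4 (1 ℕ.+ m ℕ.* 4)
  rem₂ : ∀ m → Mod4 (2 ℕ.+ m ℕ.* 4)
  rem₃ : ∀ m → Mod4 (3 ℕ.+ m ℕ.* 4)

mod4 : ∀ n → Mod4 n
mod4 zero = rem₀ 0
mod4 (suc n) with mod4 n
... | rem₀ m = rem₁ m
... | rem₁ m = rem₂ m
... | rem₂ m = rem₃ m
... | rem₃ m = rem₀ (suc m)

conv-zeroʳ : ∀ a n → conv a (λ _ → 0ℤ) n ≡ 0ℤ
conv-zeroʳ a zero    = ℤ.*-zeroʳ (a 0)
conv-zeroʳ a (suc n) = cong₂ ℤ._+_ (ℤ.*-zeroʳ (a 0)) (conv-zeroʳ (a ∘ suc) n)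

conv-cong : ∀ a {u u′ : ℕ → ℤ} → (∀ m → u m ≡ u′ m) → ∀ n → conv a u n ≡ conv a u′ n
conv-cong a u≗u′ n = conv-congʳ a n (λ m _ → u≗u′ m)

+-cong₄ : ∀ {p p′ q q′ r r′ s s′ : ℤ} → p ≡ p′ → q ≡ q′ → r ≡ r′ → s ≡ s′ →
          p ℤ.+ q ℤ.+ r ℤ.+ s ≡ p′ ℤ.+ q′ ℤ.+ r′ ℤ.+ s′
+-cong₄ refl refl refl refl = refl

conv-b₀ : ∀ u n → conv (sect 0 b) u n ≡ conv b u n
conv-b₀ u = conv-congˡ u b-0

conv-b₁ : ∀ u n → conv (sect 1 b) u n ≡ conv b u n
conv-b₁ u = conv-congˡ u b-1

conv-b₂ : ∀ u n → conv (sect 2 b) u n ≡ conv b u n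
conv-b₂ u = conv-congˡ u b-2

conv-b₃ : ∀ u n → conv (sect 3 b) u n ≡ conv b u n ℤ.+ -1ℤ ℤ.* u n
conv-b₃ u n = trans (conv-congˡ u b-3 n)
  (trans (conv-+*ˡ b unit u -1ℤ n) (cong (λ z → conv b u n ℤ.+ -1ℤ ℤ.* z) (conv-unitˡ u n)))

-- Since `(1 - x)(1 + x + x² + x³) = 1 - x⁴`, the recurrence for `f` becomes
-- `g(x) = g(x⁴) - x³ + x⁴`; `g-0` to `g-3` are its sections.
g-0 : ∀ m → sect 0 g m ≡ g m ℤ.+ 1ℤ ℤ.* X m
g-0 zero    = refl
g-0 (suc m) = trans (cong₂ ℤ._-_ (b-0 (suc m)) (b-3 m)) (rearrange (b (suc m)) (b m) (unit m))
  where
  rearrange : ∀ x y z → x ℤ.- (y ℤ.+ -1ℤ ℤ.* z) ≡ x ℤ.- y ℤ.+ 1ℤ ℤ.* z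
  rearrange = solve-∀

g-1 : ∀ m → sect 1 g m ≡ 0ℤ
g-1 m = trans (cong₂ ℤ._-_ (b-1 m) (b-0 m)) (ℤ.+-inverseʳ (b m))

g-2 : ∀ m → sect 2 g m ≡ 0ℤ
g-2 m = trans (cong₂ ℤ._-_ (b-2 m) (b-1 m)) (ℤ.+-inverseʳ (b m))

g-3 : ∀ m → sect 3 g m ≡ 0ℤ ℤ.+ -1ℤ ℤ.* unit m
g-3 m = trans (cong₂ ℤ._-_ (b-3 m) (b-2 m)) (rearrange (b m) (unit m))
  where
  rearrange : ∀ x y → x ℤ.+ -1ℤ ℤ.* y ℤ.- x ≡ 0ℤ ℤ.+ -1ℤ ℤ.* y
  rearrange = solve-∀

conv-g₀ : ∀ n → conv b (sect 0 g) n ≡ e n ℤ.+ 1ℤ ℤ.* conv b X n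
conv-g₀ n = trans (conv-cong b g-0 n) (conv-+*ʳ b g X 1ℤ n)

conv-g₁ : ∀ n → conv b (sect 1 g) n ≡ 0ℤ
conv-g₁ n = trans (conv-cong b g-1 n) (conv-zeroʳ b n)

conv-g₂ : ∀ n → conv b (sect 2 g) n ≡ 0ℤ
conv-g₂ n = trans (conv-cong b g-2 n) (conv-zeroʳ b n)

conv-g₃ : ∀ n → conv b (sect 3 g) n ≡ 0ℤ ℤ.+ -1ℤ ℤ.* b n
conv-g₃ n = trans (conv-cong b g-3 n) (trans (conv-+*ʳ b (λ _ → 0ℤ) unit -1ℤ n)
  (cong₂ (λ y z → y ℤ.+ -1ℤ ℤ.* z) (conv-zeroʳ b n) (conv-unitʳ b n)))

-- Multiplying the recurrences for `f` and `g` gives `e(x) = (1 + x + x² + x³) e(x⁴) - 2x³ g(x⁴) +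
-- x⁶ - x⁷`, which `e-0` to `e-3` split by residue.
e-0 : ∀ m → sect 0 e m ≡ e m
e-0 zero    = refl
e-0 (suc m) = trans (conv-sect₀ b g m) (trans
  (+-cong₄ (trans (conv-b₀ (sect 0 g) (suc m)) (trans (conv-g₀ (suc m))
              (cong (λ z → e (suc m) ℤ.+ 1ℤ ℤ.* z) (conv-X b m))))
           (trans (conv-b₁ (sect 3 g) m) (conv-g₃ m))
           (trans (conv-b₂ (sect 2 g) m) (conv-g₂ m))
           (trans (conv-b₃ (sect 1 g) m) (cong₂ (λ y z → y ℤ.+ -1ℤ ℤ.* z) (conv-g₁ m) (g-1 m))))
  (rearrange (e (suc m)) (b m)))
  where
  rearrange : ∀ x y → x ℤ.+ 1ℤ ℤ.* y ℤ.+ (0ℤ ℤ.+ -1ℤ ℤ.* y) ℤ.+ 0ℤ ℤ.+ 0ℤ ≡ x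
  rearrange = solve-∀

e-1 : ∀ m → sect 1 e m ≡ e m
e-1 zero    = refl
e-1 (suc m) = trans (conv-sect₁ b g m) (trans
  (+-cong₄ (trans (conv-b₀ (sect 1 g) (suc m)) (conv-g₁ (suc m)))
           (trans (conv-b₁ (sect 0 g) (suc m)) (trans (conv-g₀ (suc m))
              (cong (λ z → e (suc m) ℤ.+ 1ℤ ℤ.* z) (conv-X b m))))
           (trans (conv-b₂ (sect 3 g) m) (conv-g₃ m))
           (trans (conv-b₃ (sect 2 g) m) (cong₂ (λ y z → y ℤ.+ -1ℤ ℤ.* z) (conv-g₂ m) (g-2 m))))
  (rearrange (e (suc m)) (b m)))
  where
  rearrange : ∀ x y → 0ℤ ℤ.+ (x ℤ.+ 1ℤ ℤ.* y) ℤ.+ (0ℤ ℤ.+ -1ℤ ℤ.* y) ℤ.+ 0ℤ ≡ x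
  rearrange = solve-∀

e-2 : ∀ m → sect 2 e m ≡ e m ℤ.+ 1ℤ ℤ.* X m
e-2 zero    = refl
e-2 (suc m) = trans (conv-sect₂ b g m) (trans
  (+-cong₄ (trans (conv-b₀ (sect 2 g) (suc m)) (conv-g₂ (suc m)))
           (trans (conv-b₁ (sect 1 g) (suc m)) (conv-g₁ (suc m)))
           (trans (conv-b₂ (sect 0 g) (suc m)) (trans (conv-g₀ (suc m))
              (cong (λ z → e (suc m) ℤ.+ 1ℤ ℤ.* z) (conv-X b m))))
           (trans (conv-b₃ (sect 3 g) m) (cong₂ (λ y z → y ℤ.+ -1ℤ ℤ.* z) (conv-g₃ m) (g-3 m))))
  (rearrange (e (suc m)) (b m) (unit m)))
  where
  rearrange : ∀ x y z → 0ℤ ℤ.+ 0ℤ ℤ.+ (x ℤ.+ 1ℤ ℤ.* y)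
                        ℤ.+ (0ℤ ℤ.+ -1ℤ ℤ.* y ℤ.+ -1ℤ ℤ.* (0ℤ ℤ.+ -1ℤ ℤ.* z)) ≡ x ℤ.+ 1ℤ ℤ.* z
  rearrange = solve-∀

e-3 : ∀ m → sect 3 e m ≡ (e m ℤ.+ -[1+ 1 ] ℤ.* g m) ℤ.+ -1ℤ ℤ.* X m
e-3 zero    = refl
e-3 (suc m) = trans (conv-sect₃ b g m) (trans
  (+-cong₄ (trans (conv-b₀ (sect 3 g) (suc m)) (conv-g₃ (suc m)))
           (trans (conv-b₁ (sect 2 g) (suc m)) (conv-g₂ (suc m)))
           (trans (conv-b₂ (sect 1 g) (suc m)) (conv-g₁ (suc m)))
           (trans (conv-b₃ (sect 0 g) (suc m)) (cong₂ (λ y z → y ℤ.+ -1ℤ ℤ.* z)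
             (trans (conv-g₀ (suc m)) (cong (λ z → e (suc m) ℤ.+ 1ℤ ℤ.* z) (conv-X b m)))
             (g-0 (suc m)))))
  (rearrange (e (suc m)) (b (suc m)) (b m) (unit m)))
  where
  rearrange : ∀ x y y′ z → 0ℤ ℤ.+ -1ℤ ℤ.* y ℤ.+ 0ℤ ℤ.+ 0ℤ
                ℤ.+ ((x ℤ.+ 1ℤ ℤ.* y′) ℤ.+ -1ℤ ℤ.* (y ℤ.- y′ ℤ.+ 1ℤ ℤ.* z))
              ≡ (x ℤ.+ -[1+ 1 ] ℤ.* (y ℤ.- y′)) ℤ.+ -1ℤ ℤ.* z
  rearrange = solve-∀

conv-e₀ : ∀ n → conv b (sect 0 e) n ≡ d n
conv-e₀ = conv-cong b e-0

conv-e₁ : ∀ n → conv b (sect 1 e) n ≡ d n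
conv-e₁ = conv-cong b e-1

conv-e₂ : ∀ n → conv b (sect 2 e) (suc n) ≡ d (suc n) ℤ.+ 1ℤ ℤ.* b n
conv-e₂ n = trans (conv-cong b e-2 (suc n)) (trans (conv-+*ʳ b e X 1ℤ (suc n))
  (cong (λ z → d (suc n) ℤ.+ 1ℤ ℤ.* z) (conv-X b n)))

conv-e₃ : ∀ n → conv b (sect 3 e) (suc n) ≡ d (suc n) ℤ.+ -[1+ 1 ] ℤ.* e (suc n) ℤ.+ -1ℤ ℤ.* b n
conv-e₃ n = trans (conv-cong b e-3 (suc n))
  (trans (conv-+*ʳ b (λ m → e m ℤ.+ -[1+ 1 ] ℤ.* g m) X -1ℤ (suc n))
    (cong₂ (λ y z → y ℤ.+ -1ℤ ℤ.* z) (conv-+*ʳ b e g -[1+ 1 ] (suc n)) (conv-X b n)))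

-- One more factor `f` gives `d(x) = (1 + x + x² + x³)² d(x⁴) - 3x³ (1 + x + x² + x³) e(x⁴) + 3x⁶
-- g(x⁴) - x⁹ + x¹⁰`. The square yields the weights `1 + i` and `3 - i`; starting at `3 + m` stays
-- past the two isolated terms.
d-0 : ∀ m → sect 0 d (3 ℕ.+ m) ≡
      + 1 ℤ.* d (3 ℕ.+ m) ℤ.+ + 3 ℤ.* d (2 ℕ.+ m) ℤ.+ -[1+ 2 ] ℤ.* e (2 ℕ.+ m)
d-0 m = trans (conv-sect₀ b e (2 ℕ.+ m)) (trans
  (+-cong₄ (trans (conv-b₀ (sect 0 e) (3 ℕ.+ m)) (conv-e₀ (3 ℕ.+ m)))
           (trans (conv-b₁ (sect 3 e) (2 ℕ.+ m)) (conv-e₃ (1 ℕ.+ m)))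
           (trans (conv-b₂ (sect 2 e) (2 ℕ.+ m)) (conv-e₂ (1 ℕ.+ m)))
           (trans (conv-b₃ (sect 1 e) (2 ℕ.+ m))
             (cong₂ (λ y z → y ℤ.+ -1ℤ ℤ.* z) (conv-e₁ (2 ℕ.+ m)) (e-1 (2 ℕ.+ m)))))
  (rearrange (d (3 ℕ.+ m)) (d (2 ℕ.+ m)) (e (2 ℕ.+ m)) (b (1 ℕ.+ m))))
  where
  rearrange : ∀ D D′ E B →
    D ℤ.+ (D′ ℤ.+ -[1+ 1 ] ℤ.* E ℤ.+ -1ℤ ℤ.* B) ℤ.+ (D′ ℤ.+ 1ℤ ℤ.* B) ℤ.+ (D′ ℤ.+ -1ℤ ℤ.* E)
    ≡ + 1 ℤ.* D ℤ.+ + 3 ℤ.* D′ ℤ.+ -[1+ 2 ] ℤ.* E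
  rearrange = solve-∀

d-1 : ∀ m → sect 1 d (3 ℕ.+ m) ≡
      + 2 ℤ.* d (3 ℕ.+ m) ℤ.+ + 2 ℤ.* d (2 ℕ.+ m) ℤ.+ -[1+ 2 ] ℤ.* e (2 ℕ.+ m)
d-1 m = trans (conv-sect₁ b e (2 ℕ.+ m)) (trans
  (+-cong₄ (trans (conv-b₀ (sect 1 e) (3 ℕ.+ m)) (conv-e₁ (3 ℕ.+ m)))
           (trans (conv-b₁ (sect 0 e) (3 ℕ.+ m)) (conv-e₀ (3 ℕ.+ m)))
           (trans (conv-b₂ (sect 3 e) (2 ℕ.+ m)) (conv-e₃ (1 ℕ.+ m)))
           (trans (conv-b₃ (sect 2 e) (2 ℕ.+ m))
             (cong₂ (λ y z → y ℤ.+ -1ℤ ℤ.* z) (conv-e₂ (1 ℕ.+ m)) (e-2 (2 ℕ.+ m)))))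
  (rearrange (d (3 ℕ.+ m)) (d (2 ℕ.+ m)) (e (2 ℕ.+ m)) (b (1 ℕ.+ m))))
  where
  rearrange : ∀ D D′ E B →
    D ℤ.+ D ℤ.+ (D′ ℤ.+ -[1+ 1 ] ℤ.* E ℤ.+ -1ℤ ℤ.* B)
      ℤ.+ (D′ ℤ.+ 1ℤ ℤ.* B ℤ.+ -1ℤ ℤ.* (E ℤ.+ 0ℤ))
    ≡ + 2 ℤ.* D ℤ.+ + 2 ℤ.* D′ ℤ.+ -[1+ 2 ] ℤ.* E
  rearrange = solve-∀

d-2 : ∀ m → sect 2 d (3 ℕ.+ m) ≡
      + 3 ℤ.* d (3 ℕ.+ m) ℤ.+ + 1 ℤ.* d (2 ℕ.+ m)
      ℤ.+ -[1+ 2 ] ℤ.* (e (2 ℕ.+ m) ℤ.- g (2 ℕ.+ m))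
d-2 m = trans (conv-sect₂ b e (2 ℕ.+ m)) (trans
  (+-cong₄ (trans (conv-b₀ (sect 2 e) (3 ℕ.+ m)) (conv-e₂ (2 ℕ.+ m)))
           (trans (conv-b₁ (sect 1 e) (3 ℕ.+ m)) (conv-e₁ (3 ℕ.+ m)))
           (trans (conv-b₂ (sect 0 e) (3 ℕ.+ m)) (conv-e₀ (3 ℕ.+ m)))
           (trans (conv-b₃ (sect 3 e) (2 ℕ.+ m))
             (cong₂ (λ y z → y ℤ.+ -1ℤ ℤ.* z) (conv-e₃ (1 ℕ.+ m)) (e-3 (2 ℕ.+ m)))))
  (rearrange (d (3 ℕ.+ m)) (d (2 ℕ.+ m)) (e (2 ℕ.+ m)) (b (1 ℕ.+ m)) (b (2 ℕ.+ m))))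
  where
  rearrange : ∀ D D′ E B B′ →
    D ℤ.+ 1ℤ ℤ.* B′ ℤ.+ D ℤ.+ D
      ℤ.+ (D′ ℤ.+ -[1+ 1 ] ℤ.* E ℤ.+ -1ℤ ℤ.* B
        ℤ.+ -1ℤ ℤ.* (E ℤ.+ -[1+ 1 ] ℤ.* (B′ ℤ.- B) ℤ.+ 0ℤ))
    ≡ + 3 ℤ.* D ℤ.+ + 1 ℤ.* D′ ℤ.+ -[1+ 2 ] ℤ.* (E ℤ.- (B′ ℤ.- B))
  rearrange = solve-∀

d-3 : ∀ m → sect 3 d (3 ℕ.+ m) ≡
      + 4 ℤ.* d (3 ℕ.+ m) ℤ.+ + 0 ℤ.* d (2 ℕ.+ m) ℤ.+ -[1+ 2 ] ℤ.* e (3 ℕ.+ m)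
d-3 m = trans (conv-sect₃ b e (2 ℕ.+ m)) (trans
  (+-cong₄ (trans (conv-b₀ (sect 3 e) (3 ℕ.+ m)) (conv-e₃ (2 ℕ.+ m)))
           (trans (conv-b₁ (sect 2 e) (3 ℕ.+ m)) (conv-e₂ (2 ℕ.+ m)))
           (trans (conv-b₂ (sect 1 e) (3 ℕ.+ m)) (conv-e₁ (3 ℕ.+ m)))
           (trans (conv-b₃ (sect 0 e) (3 ℕ.+ m))
             (cong₂ (λ y z → y ℤ.+ -1ℤ ℤ.* z) (conv-e₀ (3 ℕ.+ m)) (e-0 (3 ℕ.+ m)))))
  (rearrange (d (3 ℕ.+ m)) (d (2 ℕ.+ m)) (e (3 ℕ.+ m)) (b (2 ℕ.+ m))))
  where
  rearrange : ∀ D D′ E B →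
    D ℤ.+ -[1+ 1 ] ℤ.* E ℤ.+ -1ℤ ℤ.* B ℤ.+ (D ℤ.+ 1ℤ ℤ.* B) ℤ.+ D ℤ.+ (D ℤ.+ -1ℤ ℤ.* E)
    ≡ + 4 ℤ.* D ℤ.+ + 0 ℤ.* D′ ℤ.+ -[1+ 2 ] ℤ.* E
  rearrange = solve-∀

-- Bounds for e and d

≤-slack : ∀ {x y} z → 0ℤ ℤ.≤ z → y ≡ x ℤ.+ z → x ℤ.≤ y
≤-slack {x} z 0≤z refl = subst (ℤ._≤ x ℤ.+ z) (ℤ.+-identityʳ x) (ℤ.+-monoʳ-≤ x 0≤z)

0≤k*[y-x] : ∀ k .{{_ : ℤ.NonNegative k}} {x y} → x ℤ.≤ y → 0ℤ ℤ.≤ k ℤ.* (y ℤ.- x)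
0≤k*[y-x] k {x} {y} x≤y =
  subst (ℤ._≤ k ℤ.* (y ℤ.- x)) (ℤ.*-zeroʳ k) (ℤ.*-monoˡ-≤-nonNeg k (ℤ.i≤j⇒0≤j-i x≤y))

0≤X : ∀ n → 0ℤ ℤ.≤ X n
0≤X 0             = ℤ.+≤+ z≤n
0≤X 1             = ℤ.+≤+ z≤n
0≤X (suc (suc n)) = ℤ.+≤+ z≤n

-- The second bound is what the recurrence for e (4m + 3) feeds on.
EBound : ℤ → ℤ → Set
EBound x y = (x ℤ.≤ + 2) × (x ℤ.+ -[1+ 1 ] ℤ.* y ℤ.≤ + 2)

EBound-0 : ∀ {x y} z → 0ℤ ℤ.≤ z → EBound x y → EBound x (y ℤ.+ 1ℤ ℤ.* z)
EBound-0 {x} {y} z 0≤z (p , q) =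
  p , ℤ.≤-trans (≤-slack (z ℤ.+ z) (ℤ.+-mono-≤ 0≤z 0≤z) (rearrange x y z)) q
  where
  rearrange : ∀ x y z → x ℤ.+ -[1+ 1 ] ℤ.* y
                      ≡ x ℤ.+ -[1+ 1 ] ℤ.* (y ℤ.+ 1ℤ ℤ.* z) ℤ.+ (z ℤ.+ z)
  rearrange = solve-∀

EBound-zeroʳ : ∀ {x} → x ℤ.≤ + 2 → EBound x 0ℤ
EBound-zeroʳ {x} p = p , subst (ℤ._≤ + 2) (sym (ℤ.+-identityʳ x)) p

-- Strong induction through the last base-4 digit. At residue 0 `g` can only grow, which relaxes the
-- second bound. At the other residues, small cases aside, `g` vanishes and the second bound
-- collapses to the first; at residue 3 this first bound comes from the second one at `m`.
e-bound : ∀ n → EBound (e n) (g n)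
e-bound = <-rec _ step
  where
  step : ∀ n → (∀ {m} → m ℕ.< n → EBound (e m) (g m)) → EBound (e n) (g n)
  step n rec with mod4 n
  ... | rem₀ zero    = from-yes (e 0 ℤ.≤? + 2) , from-yes (e 0 ℤ.+ -[1+ 1 ] ℤ.* g 0 ℤ.≤? + 2)
  ... | rem₀ (suc m) = subst₂ EBound (sym (e-0 (suc m))) (sym (g-0 (suc m)))
    (EBound-0 (X (suc m)) (0≤X (suc m)) (rec (ℕ.m<m*n (suc m) 4 (s≤s (s≤s z≤n)))))
  ... | rem₁ m       = subst₂ EBound (sym (e-1 m)) (sym (g-1 m))
    (EBound-zeroʳ (proj₁ (rec (s≤s (ℕ.m≤m*n m 4)))))
  ... | rem₂ 0       = from-yes (e 2 ℤ.≤? + 2) , from-yes (e 2 ℤ.+ -[1+ 1 ] ℤ.* g 2 ℤ.≤? + 2)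
  -- Index 6 is where the term `X` of `e-2` contributes; `e 6 = 2` attains the bound.
  ... | rem₂ 1       = from-yes (e 6 ℤ.≤? + 2) , from-yes (e 6 ℤ.+ -[1+ 1 ] ℤ.* g 6 ℤ.≤? + 2)
  ... | rem₂ (suc (suc m)) = subst₂ EBound
    (trans (sym (ℤ.+-identityʳ (e (2 ℕ.+ m)))) (sym (e-2 (2 ℕ.+ m)))) (sym (g-2 (2 ℕ.+ m)))
    (EBound-zeroʳ (proj₁ (rec (s≤s (ℕ.m≤n⇒m≤1+n (ℕ.m≤m*n (2 ℕ.+ m) 4))))))
  ... | rem₃ zero    = from-yes (e 3 ℤ.≤? + 2) , from-yes (e 3 ℤ.+ -[1+ 1 ] ℤ.* g 3 ℤ.≤? + 2)
  ... | rem₃ (suc m) = subst₂ EBound (sym (e-3 (suc m))) (sym (g-3 (suc m)))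
    (EBound-zeroʳ (ℤ.≤-trans
      (≤-slack (X (suc m)) (0≤X (suc m)) (rearrange (e (suc m) ℤ.+ -[1+ 1 ] ℤ.* g (suc m)) (X (suc m))))
      (proj₂ (rec (s≤s (ℕ.m≤n⇒m≤1+n (ℕ.m≤n⇒m≤1+n (ℕ.m≤m*n (suc m) 4))))))))
    where
    rearrange : ∀ x z → x ≡ x ℤ.+ -1ℤ ℤ.* z ℤ.+ z
    rearrange = solve-∀

e≤2 : ∀ n → e n ℤ.≤ + 2
e≤2 = proj₁ ∘ e-bound

-- `e n - g n` is the mean of the two quantities bounded in `EBound`.
e-g≤2 : ∀ n → e n ℤ.- g n ℤ.≤ + 2
e-g≤2 n = ℤ.*-cancelˡ-≤-pos _ _ (+ 2)
  (subst (ℤ._≤ + 4) (rearrange (e n) (g n)) (ℤ.+-mono-≤ (e≤2 n) (proj₂ (e-bound n))))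
  where
  rearrange : ∀ x y → x ℤ.+ (x ℤ.+ -[1+ 1 ] ℤ.* y) ≡ + 2 ℤ.* (x ℤ.- y)
  rearrange = solve-∀

DBound : ℕ → Set
DBound n = + n ℤ.+ + 31 ℤ.≤ + 15 ℤ.* d n

-- The slope 1/15 and the intercept 31/15 are exactly preserved by each of the
-- four recurrences for d; n = 14 is the tight case.
d-step : ∀ i .{{_ : ℤ.NonNegative (+ 1 ℤ.+ i)}} .{{_ : ℤ.NonNegative (+ 3 ℤ.- i)}} n D D′ E →
         + 1 ℤ.+ n ℤ.+ + 31 ℤ.≤ + 15 ℤ.* D → n ℤ.+ + 31 ℤ.≤ + 15 ℤ.* D′ → E ℤ.≤ + 2 →
         i ℤ.+ (+ 1 ℤ.+ n) ℤ.* + 4 ℤ.+ + 31 ℤ.≤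
         + 15 ℤ.* ((+ 1 ℤ.+ i) ℤ.* D ℤ.+ (+ 3 ℤ.- i) ℤ.* D′ ℤ.+ -[1+ 2 ] ℤ.* E)
d-step i n D D′ E p q r =
  ≤-slack _ (ℤ.+-mono-≤ (ℤ.+-mono-≤ (0≤k*[y-x] (+ 1 ℤ.+ i) p) (0≤k*[y-x] (+ 3 ℤ.- i) q))
                        (0≤k*[y-x] (+ 45) r))
    (rearrange i n D D′ E)
  where
  rearrange : ∀ i n D D′ E →
    + 15 ℤ.* ((+ 1 ℤ.+ i) ℤ.* D ℤ.+ (+ 3 ℤ.- i) ℤ.* D′ ℤ.+ -[1+ 2 ] ℤ.* E) ≡
    i ℤ.+ (+ 1 ℤ.+ n) ℤ.* + 4 ℤ.+ + 31 ℤ.+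
      ((+ 1 ℤ.+ i) ℤ.* (+ 15 ℤ.* D ℤ.- (+ 1 ℤ.+ n ℤ.+ + 31))
        ℤ.+ (+ 3 ℤ.- i) ℤ.* (+ 15 ℤ.* D′ ℤ.- (n ℤ.+ + 31)) ℤ.+ + 45 ℤ.* (+ 2 ℤ.- E))
  rearrange = solve-∀

-- `E` stays free because the recurrences subtract three times `e m`, `e m - g m` or `e (suc m)`,
-- depending on the residue; each of these is at most 2.
DBound-step : ∀ i .{{_ : ℤ.NonNegative (+ 3 ℤ.- + i)}} m E → E ℤ.≤ + 2 →
  sect i d (suc m) ≡ (+ 1 ℤ.+ + i) ℤ.* d (suc m) ℤ.+ (+ 3 ℤ.- + i) ℤ.* d m ℤ.+ -[1+ 2 ] ℤ.* E →
  DBound (suc m) → DBound m → DBound (i ℕ.+ suc m ℕ.* 4)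
DBound-step i m E E≤2 eq p q =
  subst₂ (λ y z → y ℤ.+ + 31 ℤ.≤ + 15 ℤ.* z) cast (sym eq)
    (d-step (+ i) (+ m) (d (suc m)) (d m) E p q E≤2)
  where
  cast : + i ℤ.+ + suc m ℤ.* + 4 ≡ + (i ℕ.+ suc m ℕ.* 4)
  cast = trans (cong (λ z → + i ℤ.+ z) (sym (ℤ.pos-* (suc m) 4))) (sym (ℤ.pos-+ i (suc m ℕ.* 4)))

6+m<[6+m]*4 : ∀ i m → 6 ℕ.+ m ℕ.< i ℕ.+ (6 ℕ.+ m) ℕ.* 4
6+m<[6+m]*4 i m = ℕ.<-≤-trans (ℕ.m<m*n (6 ℕ.+ m) 4 (s≤s (s≤s z≤n))) (ℕ.m≤n+m _ i)

5+m<[6+m]*4 : ∀ i m → 5 ℕ.+ m ℕ.< i ℕ.+ (6 ℕ.+ m) ℕ.* 4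
5+m<[6+m]*4 i m = ℕ.<-trans (ℕ.n<1+n (5 ℕ.+ m)) (6+m<[6+m]*4 i m)

-- With `k = i + m * 4`, the index `24 + k` is definitionally `i + (6 + m) * 4`, so the recurrences
-- call on `6 + m` and `5 + m`, both at least 5.
DBound-residues : ∀ {k} → Mod4 k → (∀ m → 5 ℕ.+ m ℕ.< 24 ℕ.+ k → DBound (5 ℕ.+ m)) → DBound (24 ℕ.+ k)
DBound-residues (rem₀ m) rec = DBound-step 0 (5 ℕ.+ m) (e (5 ℕ.+ m)) (e≤2 (5 ℕ.+ m)) (d-0 (3 ℕ.+ m))
  (rec (suc m) (6+m<[6+m]*4 0 m)) (rec m (5+m<[6+m]*4 0 m))
DBound-residues (rem₁ m) rec = DBound-step 1 (5 ℕ.+ m) (e (5 ℕ.+ m)) (e≤2 (5 ℕ.+ m)) (d-1 (3 ℕ.+ m))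
  (rec (suc m) (6+m<[6+m]*4 1 m)) (rec m (5+m<[6+m]*4 1 m))
DBound-residues (rem₂ m) rec =
  DBound-step 2 (5 ℕ.+ m) (e (5 ℕ.+ m) ℤ.- g (5 ℕ.+ m)) (e-g≤2 (5 ℕ.+ m)) (d-2 (3 ℕ.+ m))
  (rec (suc m) (6+m<[6+m]*4 2 m)) (rec m (5+m<[6+m]*4 2 m))
DBound-residues (rem₃ m) rec = DBound-step 3 (5 ℕ.+ m) (e (6 ℕ.+ m)) (e≤2 (6 ℕ.+ m)) (d-3 (3 ℕ.+ m))
  (rec (suc m) (6+m<[6+m]*4 3 m)) (rec m (5+m<[6+m]*4 3 m))

dBound : ∀ n → 5 ℕ.≤ n → DBound n
dBound = <-rec (λ n → 5 ℕ.≤ n → DBound n) λ n rec 5≤n → step n rec 5≤n (n ℕ.<? 24)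
  where
  step : ∀ n → (∀ {m} → m ℕ.< n → 5 ℕ.≤ m → DBound m) → 5 ℕ.≤ n → Dec (n ℕ.< 24) → DBound n
  step n rec 5≤n (yes n<24) = proj₂ (d-small {n} n<24) 5≤n
  step n rec 5≤n (no  n≮24) = subst DBound 24+k≡n
    (DBound-residues (mod4 (n ∸ 24)) (λ m m<n → rec (subst (5 ℕ.+ m ℕ.<_) 24+k≡n m<n) (ℕ.m≤m+n 5 m)))
    where
    24+k≡n : 24 ℕ.+ (n ∸ 24) ≡ n
    24+k≡n = ℕ.m+[n∸m]≡n (ℕ.≮⇒≥ n≮24)

d-lower : ∀ n → + suc n ℤ.≤ + 15 ℤ.* d n
d-lower n with 5 ℕ.≤? n
... | yes 5≤n = ℤ.≤-trans
  (ℤ.+≤+ (ℕ.≤-trans (ℕ.≤-reflexive (ℕ.+-comm 1 n)) (ℕ.+-monoʳ-≤ n (s≤s z≤n)))) (dBound n 5≤n)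
... | no  5≰n = proj₁ (d-small {n} (ℕ.<-≤-trans (ℕ.≰⇒> 5≰n) (ℕ.m≤m+n 5 19)))

-- The counting function of 𝓑

Σ< : ℕ → (ℕ → ℕ) → ℕ
Σ< zero    α = 0
Σ< (suc n) α = α 0 ℕ.+ Σ< n (α ∘ suc)

Σ<-cong : ∀ n {α γ} → (∀ i → α i ≡ γ i) → Σ< n α ≡ Σ< n γ
Σ<-cong zero    α≗γ = refl
Σ<-cong (suc n) α≗γ = cong₂ ℕ._+_ (α≗γ 0) (Σ<-cong n (α≗γ ∘ suc))

Σ<-zero : ∀ n {α} → (∀ i → α i ≡ 0) → Σ< n α ≡ 0
Σ<-zero zero    α≗0 = refl
Σ<-zero (suc n) α≗0 = cong₂ ℕ._+_ (α≗0 0) (Σ<-zero n (α≗0 ∘ suc))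

Σ<-monoˡ : ∀ i n α → Σ< n α ℕ.≤ Σ< (i ℕ.+ n) α
Σ<-monoˡ i zero    α = z≤n
Σ<-monoˡ i (suc n) α = subst (λ m → Σ< (suc n) α ℕ.≤ Σ< m α) (sym (ℕ.+-suc i n))
                         (ℕ.+-monoʳ-≤ (α 0) (Σ<-monoˡ i n (α ∘ suc)))

Σ<-quadruple : ∀ n α γ →
  (∀ m → α (m ℕ.* 4) ≡ γ m) → (∀ m → α (1 ℕ.+ m ℕ.* 4) ≡ γ m) →
  (∀ m → α (2 ℕ.+ m ℕ.* 4) ≡ γ m) → (∀ m → α (3 ℕ.+ m ℕ.* 4) ≡ γ m) →
  Σ< (n ℕ.* 4) α ≡ 4 ℕ.* Σ< n γ
Σ<-quadruple zero    α γ p q r s = refl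
Σ<-quadruple (suc n) α γ p q r s = trans
  (cong₂ ℕ._+_ (p 0) (cong₂ ℕ._+_ (q 0) (cong₂ ℕ._+_ (r 0) (cong₂ ℕ._+_ (s 0)
    (Σ<-quadruple n (λ i → α (4 ℕ.+ i)) (γ ∘ suc) (p ∘ suc) (q ∘ suc) (r ∘ suc) (s ∘ suc))))))
  (rearrange (γ 0) (Σ< n (γ ∘ suc)))
  where
  rearrange : ∀ x y → x ℕ.+ (x ℕ.+ (x ℕ.+ (x ℕ.+ 4 ℕ.* y))) ≡ 4 ℕ.* (x ℕ.+ y)
  rearrange = ℕ-Solver.solve-∀

-- Of 1, 2, 3 the first two count; the integers from 4 to `4m + 3` form blocks of four, each
-- repeating the value of `β` at its quotient.
β-count-quadruple : ∀ m → Σ< (3 ℕ.+ m ℕ.* 4) (β ∘ suc) ≡ 2 ℕ.+ 4 ℕ.* Σ< m (β ∘ suc)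
β-count-quadruple m = cong (2 ℕ.+_) (Σ<-quadruple m (λ i → β (4 ℕ.+ i)) (β ∘ suc)
  (λ m → ℤ.+-injective (b-0 (suc m))) (λ m → ℤ.+-injective (b-1 (suc m)))
  (λ m → ℤ.+-injective (b-2 (suc m)))
  (λ m → ℤ.+-injective (trans (b-3 (suc m)) (ℤ.+-identityʳ (b (suc m))))))

-- Writing `n = 3 + i + 4m`, the last `i` positions are discarded. The factor 3 is what pays for
-- them: `3 + i ≤ 6 = 3 * 2`, where 2 is the constant in `β-count-quadruple`.
β-count : ∀ n → n ℕ.≤ 3 ℕ.* Σ< n (β ∘ suc)
β-count = <-rec _ step
  where
  large : ∀ i m → i ℕ.≤ 3 → m ℕ.≤ 3 ℕ.* Σ< m (β ∘ suc) →
          3 ℕ.+ (i ℕ.+ m ℕ.* 4) ℕ.≤ 3 ℕ.* Σ< (3 ℕ.+ (i ℕ.+ m ℕ.* 4)) (β ∘ suc)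
  large i m i≤3 m≤ = begin
    3 ℕ.+ (i ℕ.+ m ℕ.* 4)
      ≤⟨ ℕ.+-monoʳ-≤ 3 (ℕ.+-mono-≤ i≤3 (ℕ.*-monoˡ-≤ 4 m≤)) ⟩
    3 ℕ.+ (3 ℕ.+ 3 ℕ.* Σ< m (β ∘ suc) ℕ.* 4)
      ≡⟨ rearrange (Σ< m (β ∘ suc)) ⟩
    3 ℕ.* (2 ℕ.+ 4 ℕ.* Σ< m (β ∘ suc))
      ≡⟨ cong (3 ℕ.*_) (sym (β-count-quadruple m)) ⟩
    3 ℕ.* Σ< (3 ℕ.+ m ℕ.* 4) (β ∘ suc)
      ≤⟨ ℕ.*-monoʳ-≤ 3 (Σ<-monoˡ i (3 ℕ.+ m ℕ.* 4) (β ∘ suc)) ⟩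
    3 ℕ.* Σ< (i ℕ.+ (3 ℕ.+ m ℕ.* 4)) (β ∘ suc)
      ≡⟨ cong (λ j → 3 ℕ.* Σ< j (β ∘ suc)) (swap i (m ℕ.* 4)) ⟩
    3 ℕ.* Σ< (3 ℕ.+ (i ℕ.+ m ℕ.* 4)) (β ∘ suc) ∎
    where
    open ℕ.≤-Reasoning
    rearrange : ∀ x → 3 ℕ.+ (3 ℕ.+ 3 ℕ.* x ℕ.* 4) ≡ 3 ℕ.* (2 ℕ.+ 4 ℕ.* x)
    rearrange = ℕ-Solver.solve-∀
    swap : ∀ i x → i ℕ.+ (3 ℕ.+ x) ≡ 3 ℕ.+ (i ℕ.+ x)
    swap = ℕ-Solver.solve-∀

  m< : ∀ i m → m ℕ.< 3 ℕ.+ (i ℕ.+ m ℕ.* 4)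
  m< i m = s≤s (ℕ.≤-trans (ℕ.m≤m*n m 4) (ℕ.≤-trans (ℕ.m≤n+m (m ℕ.* 4) i) (ℕ.m≤n+m _ 2)))

  residues : ∀ {k} → Mod4 k → (∀ {m} → m ℕ.< 3 ℕ.+ k → m ℕ.≤ 3 ℕ.* Σ< m (β ∘ suc)) →
             3 ℕ.+ k ℕ.≤ 3 ℕ.* Σ< (3 ℕ.+ k) (β ∘ suc)
  residues (rem₀ m) rec = large 0 m z≤n (rec (m< 0 m))
  residues (rem₁ m) rec = large 1 m (s≤s z≤n) (rec (m< 1 m))
  residues (rem₂ m) rec = large 2 m (s≤s (s≤s z≤n)) (rec (m< 2 m))
  residues (rem₃ m) rec = large 3 m ℕ.≤-refl (rec (m< 3 m))

  step : ∀ n → (∀ {m} → m ℕ.< n → m ℕ.≤ 3 ℕ.* Σ< m (β ∘ suc)) → n ℕ.≤ 3 ℕ.* Σ< n (β ∘ suc)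
  step 0 rec = z≤n
  step 1 rec = s≤s z≤n
  step 2 rec = s≤s (s≤s z≤n)
  step (suc (suc (suc k))) rec = residues (mod4 k) rec

-- Representation counts as iterated convolutions

countᵇ : ∀ {ℓ} {X : Set ℓ} → (X → Bool) → List X → ℕ
countᵇ p []       = 0
countᵇ p (x ∷ xs) = fromBool (p x) ℕ.+ countᵇ p xs

length-filter : ∀ {ℓ ℓ′} {X : Set ℓ} {P : Pred X ℓ′} (P? : Decidable P) xs →
                length (filter P? xs) ≡ countᵇ (does ∘ P?) xs
length-filter P? []       = refl
length-filter P? (x ∷ xs) with does (P? x)
... | false = length-filter P? xs
... | true  = cong suc (length-filter P? xs)

countᵇ-++ : ∀ {ℓ} {X : Set ℓ} (p : X → Bool) xs ys →
            countᵇ p (xs ++ ys) ≡ countᵇ p xs ℕ.+ countᵇ p ys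
countᵇ-++ p []       ys = refl
countᵇ-++ p (x ∷ xs) ys =
  trans (cong (fromBool (p x) ℕ.+_) (countᵇ-++ p xs ys)) (sym (ℕ.+-assoc (fromBool (p x)) _ _))

countᵇ-map : ∀ {ℓ ℓ′} {X : Set ℓ} {Y : Set ℓ′} (p : Y → Bool) (f : X → Y) xs →
             countᵇ p (map f xs) ≡ countᵇ (p ∘ f) xs
countᵇ-map p f []       = refl
countᵇ-map p f (x ∷ xs) = cong (fromBool (p (f x)) ℕ.+_) (countᵇ-map p f xs)

-- `upTo N` is `applyUpTo` of the identity; `f` is general because the induction replaces it by
-- `f ∘ suc`.
countᵇ-cartesianProductWith : ∀ {ℓ ℓ′ ℓ″} {X : Set ℓ} {Y : Set ℓ′} {Z : Set ℓ″}
  (p : Z → Bool) (_⊕_ : X → Y → Z) f n ys →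
  countᵇ p (cartesianProductWith _⊕_ (applyUpTo f n) ys) ≡ Σ< n (λ i → countᵇ (p ∘ (f i ⊕_)) ys)
countᵇ-cartesianProductWith p _⊕_ f zero    ys = refl
countᵇ-cartesianProductWith p _⊕_ f (suc n) ys = trans
  (countᵇ-++ p (map (f 0 ⊕_) ys) (cartesianProductWith _⊕_ (applyUpTo (f ∘ suc) n) ys))
  (cong₂ ℕ._+_ (countᵇ-map p (f 0 ⊕_) ys) (countᵇ-cartesianProductWith p _⊕_ (f ∘ suc) n ys))

module _ {ℓ} {X : Set ℓ} where

  countᵇ-false : ∀ (π : X → Bool) xs → countᵇ (λ x → π x ∧ false) xs ≡ 0
  countᵇ-false π []       = refl
  countᵇ-false π (x ∷ xs) with π x
  ... | false = countᵇ-false π xs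
  ... | true  = countᵇ-false π xs

  countᵇ-∧ : ∀ c (π ρ : X → Bool) xs →
             countᵇ (λ x → (c ∧ π x) ∧ ρ x) xs ≡ fromBool c ℕ.* countᵇ (λ x → π x ∧ ρ x) xs
  countᵇ-∧ true  π ρ xs       = sym (ℕ.+-identityʳ _)
  countᵇ-∧ false π ρ []       = refl
  countᵇ-∧ false π ρ (x ∷ xs) = countᵇ-∧ false π ρ xs

-- The two laws say that `κ i n` is `κ 0 (n - i)` for `i ≤ n` and 0 otherwise, without truncated
-- subtraction. Terms with `i > n` vanish, so any range longer than `n` gives the same sum.
conv-Σ< : ∀ α (κ : ℕ → ℕ → ℕ) → (∀ i → κ (suc i) 0 ≡ 0) → (∀ i n → κ (suc i) (suc n) ≡ κ i n) →
          ∀ N n → n ℕ.< N → + Σ< N (λ i → α i ℕ.* κ i n) ≡ conv (+_ ∘ α) (+_ ∘ κ 0) n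
conv-Σ< α κ κ-zero κ-suc (suc N) zero    _         =
  trans (cong +_ (trans (cong (α 0 ℕ.* κ 0 0 ℕ.+_)
                   (Σ<-zero N (λ i → trans (cong (α (suc i) ℕ.*_) (κ-zero i)) (ℕ.*-zeroʳ (α (suc i))))))
                 (ℕ.+-identityʳ (α 0 ℕ.* κ 0 0))))
        (ℤ.pos-* (α 0) (κ 0 0))
conv-Σ< α κ κ-zero κ-suc (suc N) (suc n) (s≤s n<N) =
  trans (ℤ.pos-+ (α 0 ℕ.* κ 0 (suc n)) _)
        (cong₂ ℤ._+_ (ℤ.pos-* (α 0) (κ 0 (suc n)))
          (trans (cong +_ (Σ<-cong N (λ i → cong (α (suc i) ℕ.*_) (κ-suc i n))))
                 (conv-Σ< (α ∘ suc) κ κ-zero κ-suc N n n<N)))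

r : ℕ → ℕ → ℤ
r zero    = unit
r (suc h) = conv b (r h)

-- `N` is independent of `n` because the tails of a tuple still range over `upTo N` while their
-- target drops to some `m ≤ n`.
countᵇ-tuples : ∀ h N n → n ℕ.< N →
                + countᵇ (does ∘ isRepresentation? 𝓑? h n) (tuples h (upTo N)) ≡ r h n
countᵇ-tuples zero    N zero    n<N = refl
countᵇ-tuples zero    N (suc n) n<N = refl
countᵇ-tuples (suc h) N n       n<N =
  trans (cong +_ (trans
      (countᵇ-cartesianProductWith (does ∘ isRepresentation? 𝓑? (suc h) n) Vec._∷_ (λ i → i) N vs)
      (Σ<-cong N (λ i →
        countᵇ-∧ (does (𝓑? i)) (does ∘ all? 𝓑?) (λ v → does (i ℕ.+ sum v ℕ.≟ n)) vs))))
    -- Both laws of `κ` come from the equality test: it is false on `suc _` against 0 and strips a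
    -- common `suc` by computation.
    (trans (conv-Σ< β κ (λ i → countᵇ-false (does ∘ all? 𝓑?) vs) (λ i n → refl) N n n<N)
           (conv-congʳ b n (λ m m≤n → countᵇ-tuples h N m (ℕ.≤-<-trans m≤n n<N))))
  where
  vs : List (Vec ℕ h)
  vs = tuples h (upTo N)
  κ : ℕ → ℕ → ℕ
  κ i n = countᵇ (λ v → does (all? 𝓑? v) ∧ does (i ℕ.+ sum v ℕ.≟ n)) vs

R≡r : ∀ h n → + R 𝓑? h n ≡ r h n
R≡r h n = trans (cong +_ (length-filter (isRepresentation? 𝓑? h n) (tuples h (upTo (suc n)))))
                (countᵇ-tuples h (suc n) n (ℕ.n<1+n n))

-- Bounds for general h

-- The series `(1 - x) f^h`; its coefficient at `suc n` is the difference of representation counts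
-- at `n`.
s : ℕ → ℕ → ℤ
s h = δ (r h)

s-suc : ∀ h n → s (suc h) n ≡ conv b (s h) n
s-suc h = δ-conv b (r h)

s-1 : ∀ n → s 1 n ≡ g n
s-1 zero    = conv-unitʳ b 0
s-1 (suc n) = cong₂ ℤ._-_ (conv-unitʳ b (suc n)) (conv-unitʳ b n)

s-2 : ∀ n → s 2 n ≡ e n
s-2 n = trans (s-suc 1 n) (conv-cong b s-1 n)

s-3 : ∀ n → s 3 n ≡ d n
s-3 n = trans (s-suc 2 n) (conv-cong b s-2 n)

conv-*ʳ : ∀ a u c n → conv a (λ m → c ℤ.* u m) n ≡ c ℤ.* conv a u n
conv-*ʳ a u c n = trans (conv-cong a (λ m → sym (ℤ.+-identityˡ (c ℤ.* u m))) n)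
  (trans (conv-+*ʳ a (λ _ → 0ℤ) u c n)
    (trans (cong (ℤ._+ c ℤ.* conv a u n) (conv-zeroʳ a n)) (ℤ.+-identityˡ (c ℤ.* conv a u n))))

fromBool-≤1 : ∀ x → fromBool x ℕ.≤ 1
fromBool-≤1 true  = s≤s z≤n
fromBool-≤1 false = z≤n

-- Each of the `suc n` terms is at most `C`. Values of `u` may be negative; a term with `α i = 0` is
-- bounded because `C` is a natural number.
conv-upper : ∀ α (u : ℕ → ℤ) C n → (∀ i → α i ℕ.≤ 1) → (∀ m → m ℕ.≤ n → u m ℤ.≤ + C) →
             conv (+_ ∘ α) u n ℤ.≤ + (suc n ℕ.* C)
conv-upper α u C n α≤1 u≤C = go α n α≤1 u≤C
  where
  term : ∀ k {x} → k ℕ.≤ 1 → x ℤ.≤ + C → + k ℤ.* x ℤ.≤ + C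
  term 0 {x} _ _   = ℤ.+≤+ z≤n
  term 1 {x} _ x≤C = subst (ℤ._≤ + C) (sym (ℤ.*-identityˡ x)) x≤C
  term (suc (suc _)) (s≤s ()) _

  go : ∀ α n → (∀ i → α i ℕ.≤ 1) → (∀ m → m ℕ.≤ n → u m ℤ.≤ + C) →
       conv (+_ ∘ α) u n ℤ.≤ + (suc n ℕ.* C)
  go α zero    α≤1 u≤C =
    ℤ.≤-trans (term (α 0) (α≤1 0) (u≤C 0 z≤n)) (ℤ.+≤+ (ℕ.≤-reflexive (sym (ℕ.+-identityʳ C))))
  go α (suc n) α≤1 u≤C =
    ℤ.+-mono-≤ (term (α 0) (α≤1 0) (u≤C (suc n) ℕ.≤-refl))
               (go (α ∘ suc) n (α≤1 ∘ suc) (λ m m≤n → u≤C m (ℕ.m≤n⇒m≤1+n m≤n)))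

-- For `i ≤ p` the partner index `p + q - i` is at least `q`, so `α i` is weighted by at least `L`;
-- the terms with `i > p` are nonnegative and are dropped.
conv-lower : ∀ α (u : ℕ → ℤ) L p q → (∀ m → 0ℤ ℤ.≤ u m) → (∀ m → q ℕ.≤ m → + L ℤ.≤ u m) →
             + (Σ< (suc p) α ℕ.* L) ℤ.≤ conv (+_ ∘ α) u (p ℕ.+ q)
conv-lower α u L p q 0≤u L≤u = go α p
  where
  0≤k*x : ∀ k {x} → 0ℤ ℤ.≤ x → 0ℤ ℤ.≤ + k ℤ.* x
  0≤k*x k {x} 0≤x = subst (ℤ._≤ + k ℤ.* x) (ℤ.*-zeroʳ (+ k)) (ℤ.*-monoˡ-≤-nonNeg (+ k) 0≤x)

  0≤conv : ∀ α n → 0ℤ ℤ.≤ conv (+_ ∘ α) u n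
  0≤conv α zero    = 0≤k*x (α 0) (0≤u 0)
  0≤conv α (suc n) = ℤ.+-mono-≤ (0≤k*x (α 0) (0≤u (suc n))) (0≤conv (α ∘ suc) n)

  term : ∀ k {x} → + L ℤ.≤ x → + (k ℕ.* L) ℤ.≤ + k ℤ.* x
  term k {x} L≤x = subst (ℤ._≤ + k ℤ.* x) (sym (ℤ.pos-* k L)) (ℤ.*-monoˡ-≤-nonNeg (+ k) L≤x)

  first : ∀ α q′ → q ℕ.≤ q′ → + (α 0 ℕ.* L) ℤ.≤ conv (+_ ∘ α) u q′
  first α zero     q≤ = term (α 0) (L≤u 0 q≤)
  first α (suc q′) q≤ = subst (ℤ._≤ conv (+_ ∘ α) u (suc q′)) (ℤ.+-identityʳ _)
    (ℤ.+-mono-≤ (term (α 0) (L≤u (suc q′) q≤)) (0≤conv (α ∘ suc) q′))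

  go : ∀ α p → + (Σ< (suc p) α ℕ.* L) ℤ.≤ conv (+_ ∘ α) u (p ℕ.+ q)
  go α zero    = subst (λ k → + (k ℕ.* L) ℤ.≤ conv (+_ ∘ α) u q) (sym (ℕ.+-identityʳ (α 0)))
                   (first α q ℕ.≤-refl)
  go α (suc p) = subst (λ k → + k ℤ.≤ conv (+_ ∘ α) u (suc p ℕ.+ q))
    (sym (ℕ.*-distribʳ-+ L (α 0) (Σ< (suc p) (α ∘ suc))))
    (ℤ.+-mono-≤ (term (α 0) (L≤u (suc p ℕ.+ q) (ℕ.m≤n+m q (suc p)))) (go (α ∘ suc) p))

-- The start is `e ≤ 2`; every convolution with `b` has `suc n` terms and so costs one factor
-- `suc n`.
s-upper : ∀ k n → s (3 ℕ.+ k) n ℤ.≤ + (2 ℕ.* suc n ^ suc k)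
s-upper zero    n = subst (ℤ._≤ + (2 ℕ.* suc n ^ 1)) (sym (s-3 n))
  (subst (λ x → d n ℤ.≤ + x) (rearrange (suc n))
    (conv-upper β e 2 n (λ i → fromBool-≤1 (does (𝓑? i))) (λ m _ → e≤2 m)))
  where
  rearrange : ∀ x → x ℕ.* 2 ≡ 2 ℕ.* (x ℕ.* 1)
  rearrange = ℕ-Solver.solve-∀
s-upper (suc k) n = subst (ℤ._≤ + (2 ℕ.* suc n ^ suc (suc k))) (sym (s-suc (3 ℕ.+ k) n))
  (subst (λ x → conv b (s (3 ℕ.+ k)) n ℤ.≤ + x) (rearrange (suc n) (suc n ^ suc k))
    (conv-upper β (s (3 ℕ.+ k)) (2 ℕ.* suc n ^ suc k) n (λ i → fromBool-≤1 (does (𝓑? i)))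
      (λ m m≤n → ℤ.≤-trans (s-upper k m) (ℤ.+≤+ (ℕ.*-monoʳ-≤ 2 (ℕ.^-monoˡ-≤ (suc k) (s≤s m≤n)))))))
  where
  rearrange : ∀ x y → x ℕ.* (2 ℕ.* y) ≡ 2 ℕ.* (x ℕ.* y)
  rearrange = ℕ-Solver.solve-∀

^-distribʳ-* : ∀ k x y → (x ℕ.* y) ^ k ≡ x ^ k ℕ.* y ^ k
^-distribʳ-* zero    x y = refl
^-distribʳ-* (suc k) x y =
  trans (cong (x ℕ.* y ℕ.*_) (^-distribʳ-* k x y)) (rearrange x y (x ^ k) (y ^ k))
  where
  rearrange : ∀ x y z w → x ℕ.* y ℕ.* (z ℕ.* w) ≡ x ℕ.* z ℕ.* (y ℕ.* w)
  rearrange = ℕ-Solver.solve-∀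

-- The inverse of the lower constant for `h = 3 + k`. The 15 is from `d-lower`; each convolution
-- costs 6 for the density of `𝓑` on half the range and `2 ^ suc k` for evaluating a power at half
-- the index.
scale : ℕ → ℕ
scale zero    = 15
scale (suc k) = 6 ℕ.* 2 ^ suc k ℕ.* scale k

-- Both `suc p` and `q` are at most `3 + p`, and `β-count` bounds `p`; the constants 3 are absorbed
-- by the element 0 of `𝓑`, which contributes the 1 in `1 + x`.
suc≤6Σ<β : ∀ p q → q ℕ.≤ suc p → suc (p ℕ.+ q) ℕ.≤ 6 ℕ.* Σ< (suc p) β
suc≤6Σ<β p q q≤1+p = begin
  suc p ℕ.+ q
    ≤⟨ ℕ.+-mono-≤ (ℕ.m≤n+m (suc p) 2) (ℕ.≤-trans q≤1+p (ℕ.m≤n+m (suc p) 2)) ⟩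
  (3 ℕ.+ p) ℕ.+ (3 ℕ.+ p)
    ≤⟨ ℕ.+-mono-≤ (ℕ.+-monoʳ-≤ 3 (β-count p)) (ℕ.+-monoʳ-≤ 3 (β-count p)) ⟩
  (3 ℕ.+ 3 ℕ.* x) ℕ.+ (3 ℕ.+ 3 ℕ.* x)
    ≡⟨ rearrange x ⟩
  6 ℕ.* (1 ℕ.+ x) ∎
  where
  open ℕ.≤-Reasoning
  x : ℕ
  x = Σ< p (β ∘ suc)
  rearrange : ∀ x → (3 ℕ.+ 3 ℕ.* x) ℕ.+ (3 ℕ.+ 3 ℕ.* x) ≡ 6 ℕ.* (1 ℕ.+ x)
  rearrange = ℕ-Solver.solve-∀

-- For the inductive step `n` is halved into `p + q`: elements of `𝓑` up to `p` are a positive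
-- proportion of `n`, and each meets a coefficient of index at least `q`, where the hypothesis
-- applies. The factor `scale k` is kept inside `u` to stay in the integers.
s-lower : ∀ k n → + (suc n ^ suc k) ℤ.≤ + scale k ℤ.* s (3 ℕ.+ k) n
s-lower zero    n = subst (λ x → + x ℤ.≤ + 15 ℤ.* s 3 n) (sym (ℕ.*-identityʳ (suc n)))
  (subst (λ x → + suc n ℤ.≤ + 15 ℤ.* x) (sym (s-3 n)) (d-lower n))
s-lower (suc k) n = subst (λ m → + (suc m ^ suc (suc k)) ℤ.≤ + scale (suc k) ℤ.* s (4 ℕ.+ k) m)
                      (ℕ.⌊n/2⌋+⌈n/2⌉≡n n)
                      -- The ceiling of `n / 2` is the floor of `suc n / 2`, and the ceiling of
                      -- `suc n / 2` is one more than the floor of `n / 2`; hence `q ≤ suc p`.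
                      (split ℕ.⌊ n /2⌋ ℕ.⌈ n /2⌉ (ℕ.⌊n/2⌋≤⌈n/2⌉ n) (ℕ.⌊n/2⌋≤⌈n/2⌉ (suc n)))
  where
  L : ℕ → ℕ
  L q = suc q ^ suc k
  u : ℕ → ℤ
  u m = + scale k ℤ.* s (3 ℕ.+ k) m

  powers : ∀ p q → p ℕ.≤ q → q ℕ.≤ suc p →
           suc (p ℕ.+ q) ^ suc (suc k) ℕ.≤ 6 ℕ.* 2 ^ suc k ℕ.* (Σ< (suc p) β ℕ.* L q)
  powers p q p≤q q≤1+p = begin
    suc (p ℕ.+ q) ℕ.* suc (p ℕ.+ q) ^ suc k
      ≤⟨ ℕ.*-mono-≤ (suc≤6Σ<β p q q≤1+p) (ℕ.^-monoˡ-≤ (suc k) doubling) ⟩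
    6 ℕ.* Σ< (suc p) β ℕ.* (2 ℕ.* suc q) ^ suc k
      ≡⟨ cong (6 ℕ.* Σ< (suc p) β ℕ.*_) (^-distribʳ-* (suc k) 2 (suc q)) ⟩
    6 ℕ.* Σ< (suc p) β ℕ.* (2 ^ suc k ℕ.* L q)
      ≡⟨ rearrange (Σ< (suc p) β) (2 ^ suc k) (L q) ⟩
    6 ℕ.* 2 ^ suc k ℕ.* (Σ< (suc p) β ℕ.* L q) ∎
    where
    open ℕ.≤-Reasoning
    doubling : suc (p ℕ.+ q) ℕ.≤ 2 ℕ.* suc q
    doubling = s≤s (ℕ.+-mono-≤ p≤q
      (ℕ.≤-trans (ℕ.n≤1+n q) (ℕ.≤-reflexive (sym (ℕ.+-identityʳ (suc q))))))
    rearrange : ∀ x y z → 6 ℕ.* x ℕ.* (y ℕ.* z) ≡ 6 ℕ.* y ℕ.* (x ℕ.* z)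
    rearrange = ℕ-Solver.solve-∀

  L≤u : ∀ q m → q ℕ.≤ m → + L q ℤ.≤ u m
  L≤u q m q≤m = ℤ.≤-trans (ℤ.+≤+ (ℕ.^-monoˡ-≤ (suc k) (s≤s q≤m))) (s-lower k m)

  split : ∀ p q → p ℕ.≤ q → q ℕ.≤ suc p →
          + (suc (p ℕ.+ q) ^ suc (suc k)) ℤ.≤ + scale (suc k) ℤ.* s (4 ℕ.+ k) (p ℕ.+ q)
  split p q p≤q q≤1+p = begin
    + (suc (p ℕ.+ q) ^ suc (suc k))
      ≤⟨ ℤ.+≤+ (powers p q p≤q q≤1+p) ⟩
    + (6 ℕ.* 2 ^ suc k ℕ.* (Σ< (suc p) β ℕ.* L q))
      ≡⟨ ℤ.pos-* (6 ℕ.* 2 ^ suc k) (Σ< (suc p) β ℕ.* L q) ⟩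
    + (6 ℕ.* 2 ^ suc k) ℤ.* + (Σ< (suc p) β ℕ.* L q)
      ≤⟨ ℤ.*-monoˡ-≤-nonNeg (+ (6 ℕ.* 2 ^ suc k))
           (conv-lower β u (L q) p q (λ m → ℤ.≤-trans (ℤ.+≤+ z≤n) (s-lower k m)) (L≤u q)) ⟩
    + (6 ℕ.* 2 ^ suc k) ℤ.* conv b u (p ℕ.+ q)
      ≡⟨ cong (+ (6 ℕ.* 2 ^ suc k) ℤ.*_) (trans (conv-*ʳ b (s (3 ℕ.+ k)) (+ scale k) (p ℕ.+ q))
           (cong (+ scale k ℤ.*_) (sym (s-suc (3 ℕ.+ k) (p ℕ.+ q))))) ⟩
    + (6 ℕ.* 2 ^ suc k) ℤ.* (+ scale k ℤ.* s (4 ℕ.+ k) (p ℕ.+ q))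
      ≡⟨ sym (ℤ.*-assoc (+ (6 ℕ.* 2 ^ suc k)) (+ scale k) (s (4 ℕ.+ k) (p ℕ.+ q))) ⟩
    + (6 ℕ.* 2 ^ suc k) ℤ.* + scale k ℤ.* s (4 ℕ.+ k) (p ℕ.+ q)
      ≡⟨ cong (ℤ._* s (4 ℕ.+ k) (p ℕ.+ q)) (sym (ℤ.pos-* (6 ℕ.* 2 ^ suc k) (scale k))) ⟩
    + scale (suc k) ℤ.* s (4 ℕ.+ k) (p ℕ.+ q) ∎
    where open ℤ.≤-Reasoning

-- Rational constants and the final inequalities

scale-nonZero : ∀ k → ℕ.NonZero (scale k)
scale-nonZero zero    = _
scale-nonZero (suc k) =
  ℕ.m*n≢0 (6 ℕ.* 2 ^ suc k) (scale k)
    {{ℕ.m*n≢0 6 (2 ^ suc k) {{_}} {{ℕ.m^n≢0 2 (suc k)}}}} {{scale-nonZero k}}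

-- `ℚ` keeps lowest terms; among unnormalised rationals the product is an explicit fraction, and
-- inequalities become cross-multiplied integer ones.
toℚᵘ-/-*-fromℤ : ∀ a k x → ℚ.toℚᵘ ((a ℚ./ suc k) * fromℤ x) ℚᵘ.≃ ℚᵘ.mkℚᵘ a k ℚᵘ.* ℚᵘ.mkℚᵘ x 0
toℚᵘ-/-*-fromℤ a k x = ℚᵘ.≃-trans (ℚ.toℚᵘ-homo-* (a ℚ./ suc k) (fromℤ x))
  (ℚᵘ.*-cong (ℚ.toℚᵘ-fromℚᵘ (ℚᵘ.mkℚᵘ a k)) (ℚ.toℚᵘ-fromℚᵘ (ℚᵘ.mkℚᵘ x 0)))

1/K*x≤y : ∀ K .{{_ : ℕ.NonZero K}} {x y} → x ℤ.≤ + K ℤ.* y → (+ 1 ℚ./ K) * fromℤ x ≤ fromℤ y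
1/K*x≤y (suc k) {x} {y} x≤Ky = ℚ.toℚᵘ-cancel-≤
  (ℚᵘ.≤-respˡ-≃ (ℚᵘ.≃-sym (toℚᵘ-/-*-fromℤ (+ 1) k x))
    (ℚᵘ.≤-respʳ-≃ (ℚᵘ.≃-sym (ℚ.toℚᵘ-fromℚᵘ (ℚᵘ.mkℚᵘ y 0)))
      (ℚᵘ.*≤* (subst₂ ℤ._≤_ (sym (lhs x)) rhs x≤Ky))))
  where
  lhs : ∀ x → + 1 ℤ.* x ℤ.* + 1 ≡ x
  lhs = solve-∀
  rhs : + suc k ℤ.* y ≡ y ℤ.* + suc (k ℕ.* 1)
  rhs = trans (ℤ.*-comm (+ suc k) y) (cong (λ m → y ℤ.* + suc m) (sym (ℕ.*-identityʳ k)))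

y≤C*x : ∀ C {x y} → y ℤ.≤ + C ℤ.* x → fromℤ y ≤ fromℤ (+ C) * fromℤ x
y≤C*x C {x} {y} y≤Cx = ℚ.toℚᵘ-cancel-≤
  (ℚᵘ.≤-respˡ-≃ (ℚᵘ.≃-sym (ℚ.toℚᵘ-fromℚᵘ (ℚᵘ.mkℚᵘ y 0)))
    (ℚᵘ.≤-respʳ-≃ (ℚᵘ.≃-sym (toℚᵘ-/-*-fromℤ (+ C) 0 x))
      (ℚᵘ.*≤* (subst₂ ℤ._≤_ (sym (ℤ.*-identityʳ y)) (sym (ℤ.*-identityʳ (+ C ℤ.* x))) y≤Cx))))

0<m/n : ∀ m n .{{_ : ℕ.NonZero m}} .{{_ : ℕ.NonZero n}} → 0ℚ < + m ℚ./ n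
0<m/n m n = ℚ.positive⁻¹ (+ m ℚ./ n) {{ℚ.normalize-pos m n}}

ΔR≡s : ∀ h n → ΔR𝓑 h n ≡ s h (suc n)
ΔR≡s h n = cong₂ ℤ._-_ (R≡r h (suc n)) (R≡r h n)

-- The base `n + 2` is positive even at `n = 0`, so this one bound gives both the growth and the
-- strict positivity.
ΔR-lower : ∀ k n → + (suc (suc n) ^ suc k) ℤ.≤ + scale k ℤ.* ΔR𝓑 (3 ℕ.+ k) n
ΔR-lower k n = subst (λ x → + (suc (suc n) ^ suc k) ℤ.≤ + scale k ℤ.* x) (sym (ΔR≡s (3 ℕ.+ k) n))
                 (s-lower k (suc n))

-- For `n ≥ 1` one has `n + 2 ≤ 3n`, which costs the factor `3 ^ suc k`.
ΔR-upper : ∀ k n → 1 ℕ.≤ n → ΔR𝓑 (3 ℕ.+ k) n ℤ.≤ + (2 ℕ.* 3 ^ suc k) ℤ.* + (n ^ suc k)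
ΔR-upper k n 1≤n = begin
  ΔR𝓑 (3 ℕ.+ k) n                              ≡⟨ ΔR≡s (3 ℕ.+ k) n ⟩
  s (3 ℕ.+ k) (suc n)                          ≤⟨ s-upper k (suc n) ⟩
  + (2 ℕ.* (2 ℕ.+ n) ^ suc k)                  ≤⟨ ℤ.+≤+ (ℕ.*-monoʳ-≤ 2 (ℕ.^-monoˡ-≤ (suc k) 2+n≤3*n)) ⟩
  + (2 ℕ.* (3 ℕ.* n) ^ suc k)                  ≡⟨ cong (λ x → + (2 ℕ.* x)) (^-distribʳ-* (suc k) 3 n) ⟩
  + (2 ℕ.* (3 ^ suc k ℕ.* n ^ suc k))          ≡⟨ cong +_ (sym (ℕ.*-assoc 2 (3 ^ suc k) (n ^ suc k))) ⟩
  + (2 ℕ.* 3 ^ suc k ℕ.* n ^ suc k)            ≡⟨ ℤ.pos-* (2 ℕ.* 3 ^ suc k) (n ^ suc k) ⟩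
  + (2 ℕ.* 3 ^ suc k) ℤ.* + (n ^ suc k)        ∎
  where
  open ℤ.≤-Reasoning
  2+n≤3*n : 2 ℕ.+ n ℕ.≤ 3 ℕ.* n
  2+n≤3*n = ℕ.≤-trans (ℕ.+-monoˡ-≤ n (ℕ.*-monoʳ-≤ 2 1≤n)) (ℕ.≤-reflexive (rearrange n))
    where
    rearrange : ∀ n → 2 ℕ.* n ℕ.+ n ≡ 3 ℕ.* n
    rearrange = ℕ-Solver.solve-∀

ΔR-positive : ∀ k n → 0ℤ ℤ.< ΔR𝓑 (3 ℕ.+ k) n
ΔR-positive k n = ℤ.*-cancelˡ-<-nonNeg (+ scale k)
  (subst (ℤ._< + scale k ℤ.* ΔR𝓑 (3 ℕ.+ k) n) (sym (ℤ.*-zeroʳ (+ scale k)))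
    (ℤ.<-≤-trans (ℤ.+<+ (ℕ.m^n>0 (suc (suc n)) (suc k))) (ΔR-lower k n)))

theorem1p1 : (h : ℕ) → 3 ℕ.≤ h →
    (∃₂ λ (c C : ℚ) → 0ℚ < c × 0ℚ < C ×
    ((n : ℕ) → 1 ℕ.≤ n →
    (c * fromℤ (+ (n ^ (h ∸ 2))) ≤ fromℤ (ΔR𝓑 h n)) ×
    (fromℤ (ΔR𝓑 h n) ≤ C * fromℤ (+ (n ^ (h ∸ 2))))))
    ×
    ((n : ℕ) → ΔR𝓑 h n ℤ.> 0ℤ)
theorem1p1 (suc (suc (suc k))) (s≤s (s≤s (s≤s _))) =
  ( + 1 ℚ./ scale k , fromℤ (+ C) , 0<m/n 1 (scale k) , 0<m/n C 1
  , λ n 1≤n → 1/K*x≤y (scale k) (ℤ.≤-trans (ℤ.+≤+ (ℕ.^-monoˡ-≤ (suc k) (ℕ.m≤n+m n 2))) (ΔR-lower k n))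
            , y≤C*x C (ΔR-upper k n 1≤n) )
  , ΔR-positive k
  where
  C : ℕ
  C = 2 ℕ.* 3 ^ suc k
  instance
    scale≢0 : ℕ.NonZero (scale k)
    scale≢0 = scale-nonZero k
    C≢0 : ℕ.NonZero C
    C≢0 = ℕ.m*n≢0 2 (3 ^ suc k) {{_}} {{ℕ.m^n≢0 3 (suc k)}}
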